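{- Let $m=4$, $t=2$, and let $n,\lambda$ be positive integers with $4\le\lambda\le\frac{n(n-1)}{2}$. \begin{enumerate} \item[(a)] If $\mu(\lambda,4;2)\ge n-1$ and $2\lambda\ge 3n$, then there exists a $(2+1)$-color connected colored edge graph $G(V,E,C,f)$ with $|V|=n$, $|E|=\lambda$, $|C|=4$. \item[(b)] Suppose $2\lambda\ge 3n$, and suppose that: if $n=2k$ for some integer $k>0$ then $\lambda\ge 4k-1$; and if $n=2k+1$ for some integer $k>0$ then $\lambda\ge 4k$. Then there exists a $(2+1)$-color connected colored edge graph $G(V,E,C,f)$ with $|V|=n$, $|E|=\lambda$, $|C|=4$. \end{enumerate}
   Context: All graphs are finite, undirected and simple (no loops, no multiple edges). A colored edge graph is a tuple $G(V,E,C,f)$ where $(V,E)$ is a graph with node set $V$ and edge set $E$, $C$ is a finite set of colors, and $f:E\to C$ is a surjective map. For an integer $t\ge 1$, two distinct nodes $A,B\in V$ are $(t+1)$-color connected if for every color set $C_t\subseteq C$ with $|C_t|=t$ there is a path from $A$ to $B$ in $G$ none of whose edges has a color in $C_t$. The colored edge graph $G$ is $(t+1)$-color connected if every two distinct nodes of $G$ are $(t+1)$-color connected. A $(\lambda,m)$-partition is a pair $(X,\mathcal{F})$ where $X$ is a finite set with $|X|=\lambda$ and $\mathcal{F}$ is a set of mutually disjoint subsets of $X$ with $|\mathcal{F}|=m$ and $X=\bigcup_{P\in\mathcal{F}}P$. For $1\le t\le m$ put $\mu(X,\mathcal{F};t)=\min\{|X\setminus(B_1\cup\cdots\cup B_t)|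 : B_1,\ldots,B_t \text{ distinct elements of } \mathcal{F}\}$, and $\mu(\lambda,m;t)=\max\{\mu(X,\mathcal{F};t): (X,\mathcal{F})\text{ is a }(\lambda,m)\text{ -partition}\}$. -}

module Defs where

open import Data.Fin using (Fin; _<_)
open import Data.Fin.Subset using (Subset; ∣_∣; _∈_; _∉_; _∩_; ∁; ⋃; Empty)
open import Data.List using (List; []; _∷_; tabulate)
open import Data.List.Relation.Unary.All using (All)
open import Data.List.Relation.Unary.Unique.Propositional using (Unique)
open import Data.Nat using (ℕ; _≤_)
open import Data.Product using (Σ; ∃; _×_; _,_; proj₁; proj₂)
open import Data.Sum using (_⊎_)
open import Function.Definitions using (Injective; Surjective)
open import Relation.Binary.Construct.Closure.ReflexiveTransitive using (Star; ε; _◅_)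
open import Relation.Binary.PropositionalEquality using (_≡_; _≢_)

-- V, E and C are enumerated by Fin.  An unordered pair of distinct nodes is
-- represented by its increasing ordered pair, so `ordered` excludes loops and
-- `simple` excludes multiple edges.
record ColoredEdgeGraph : Set where
  field
    ∣V∣ ∣E∣ ∣C∣ : ℕ

  V : Set
  V = Fin ∣V∣

  E : Set
  E = Fin ∣E∣

  C : Set
  C = Fin ∣C∣

  field
    ends       : E → V × V
    ordered    : ∀ e → proj₁ (ends e) < proj₂ (ends e)
    simple     : Injective _≡_ _≡_ ends
    f          : E → C
    surjective : Surjective _≡_ _≡_ f

  Step : V → V → Set
  Step u v = Σ E λ e → (ends e ≡ (u , v)) ⊎ (ends e ≡ (v , u))

  Walk : V → V → Set
  Walk = Star Step

  nodes : ∀ {u v} → Walk u v → List V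
  nodes {u} ε       = u ∷ []
  nodes {u} (_ ◅ w) = u ∷ nodes w

  edges : ∀ {u v} → Walk u v → List E
  edges ε             = []
  edges ((e , _) ◅ w) = e ∷ edges w

  -- A path visits no node twice.
  Path : V → V → Set
  Path u v = Σ (Walk u v) λ w → Unique (nodes w)

  _avoids_ : ∀ {u v} → Path u v → Subset ∣C∣ → Set
  (w , _) avoids Cₜ = All (λ e → f e ∉ Cₜ) (edges w)

  Nodes[_+1]-ColorConnected : ℕ → V → V → Set
  Nodes[ t +1]-ColorConnected A B =
    ∀ (Cₜ : Subset ∣C∣) → ∣ Cₜ ∣ ≡ t → Σ (Path A B) λ p → p avoids Cₜ

open ColoredEdgeGraph using (∣V∣; ∣E∣; ∣C∣) public

Is[_+1]-ColorConnected : ℕ → ColoredEdgeGraph → Set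
Is[ t +1]-ColorConnected G = ∀ (A B : V) → A ≢ B → Nodes[ t +1]-ColorConnected A B
  where open ColoredEdgeGraph G

-- The ground set is Fin l.  The family is indexed injectively, so it has
-- exactly m members; at most one of them may be empty.
record Partition (l m : ℕ) : Set where
  field
    block    : Fin m → Subset l
    distinct : Injective _≡_ _≡_ block
    disjoint : ∀ i j → i ≢ j → Empty (block i ∩ block j)
    covers   : ∀ x → ∃ λ i → x ∈ block i

IsMinimum IsMaximum : (ℕ → Set) → ℕ → Set
IsMinimum P k = P k × (∀ j → P j → k ≤ j)
IsMaximum P k = P k × (∀ j → P j → j ≤ k)

-- k is |X ∖ (B₁ ∪ ⋯ ∪ Bₜ)| for some distinct blocks B₁, …, Bₜ.
Remainder : ∀ {l m} → Partition l m → ℕ → ℕ → Set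
Remainder {m = m} 𝓕 t k =
  Σ (Fin t → Fin m) λ B →
    Injective _≡_ _≡_ B × ∣ ∁ (⋃ (tabulate λ i → block (B i))) ∣ ≡ k
  where open Partition 𝓕

-- μ is given by its graph:  μ[ 𝓕 ⨾ t ]≡ k  reads  μ(X,𝓕;t) = k,  and
-- μ[ l , m ⨾ t ]≡ k  reads  μ(l,m;t) = k.
μ[_⨾_]≡_ : ∀ {l m} → Partition l m → ℕ → ℕ → Set
μ[ 𝓕 ⨾ t ]≡ k = IsMinimum (Remainder 𝓕 t) k

μ[_,_⨾_]≡_ : ℕ → ℕ → ℕ → ℕ → Set
μ[ l , m ⨾ t ]≡ k = IsMaximum (λ j → Σ (Partition l m) λ 𝓕 → μ[ 𝓕 ⨾ t ]≡ j) k

{-# OPTIONS --safe #-}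
module Submission where

-- Deleting two of four colours leaves the union of the other two classes, so it
-- suffices that any two colour classes together connect all nodes.  For odd n the
-- minimal number of edges 2 n − 2 is reached from a coloured subgraph of K₅ by
-- repeatedly adding two nodes and four edges, one per colour; for even n a node
-- joined by edges of three different colours is added to the graph on n − 1 nodes,
-- which gives 2 n − 1 edges.  Further edges never destroy connectivity.  In part (a)
-- any two of the four blocks have at least n − 1 elements together, which yields
-- the same lower bounds on l as in part (b).

-- With _,_ in scope, μ[ l , 4 ⨾ 2 ]≡ μ would also parse as μ[_⨾_]≡_ applied to a pair.
open import Defs hiding (μ[_⨾_]≡_)
open import Data.Bool using (true; false)
open import Data.Empty using (⊥-elim)
open import Data.Fin using (Fin; zero; suc; _≟_; splitAt; join)
import Data.Fin as Fin
open import Data.Fin.Patterns using (0F; 1F; 2F; 3F; 4F)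
open import Data.Fin.Properties
  using (all?; any?; suc-injective; injective⇒≤; join-splitAt; _<?_)
import Data.Fin.Properties as Finₚ
open import Data.Fin.Subset
  using (Subset; ∣_∣; _∈_; _∉_; _⊆_; _∩_; _∪_; ∁; ⋃; Empty)
open import Data.Fin.Subset.Properties
  using (x∈p∪q⁻; x∈p∪q⁺; x∈p∩q⁺; x∈∁p⇒x∉p; x∉p⇒x∈∁p; p⊆q⇒∣p∣≤∣q∣; ∣∁p∣≡n∸∣p∣; ∣p∣≤n)
open import Data.List using ([]; _∷_; tabulate)
open import Data.List.Membership.Propositional using () renaming (_∈_ to _∈ˡ_)
open import Data.List.Relation.Unary.All using (All; []; _∷_)
open import Data.List.Relation.Unary.All.Properties using (¬Any⇒All¬)
open import Data.List.Relation.Unary.AllPairs using ([]; _∷_)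
open import Data.List.Relation.Unary.Any using (here; there)
open import Data.List.Relation.Unary.Unique.Propositional using (Unique)
open import Data.Nat using (ℕ; zero; suc; _+_; _*_; _∸_; _/_; _≤_; _<_; z≤n; s≤s; s≤s⁻¹; s<s; z<s)
open import Data.Nat.DivMod using (m*n/n≡m)
open import Data.Nat.Properties as ℕₚ using (≤-trans; ≤-reflexive; +-mono-≤)
open import Data.Nat.Tactic.RingSolver using (solve-∀)
open import Data.Product using (Σ; ∃; ∃₂; _×_; _,_; proj₁; proj₂)
import Data.Product as Product
open import Data.Product.Properties using (≡-dec; ,-injectiveˡ; ,-injectiveʳ)
open import Data.Sum using (_⊎_; inj₁; inj₂; [_,_]′)
import Data.Sum as Sum
open import Data.Vec using ([]; _∷_; here; there; lookup)
open import Data.Vec.Functional using (updateAt) renaming (_∷_ to _∷ᶠ_)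
open import Data.Vec.Functional.Properties using (updateAt-updates; updateAt-minimal)
open import Function using (_∘_; id; const)
open import Function.Definitions using (Injective)
open import Relation.Binary.Construct.Closure.ReflexiveTransitive
  using (Star; ε; _◅_; _◅◅_; kleisliStar; reverse; return)
open import Relation.Binary.PropositionalEquality
  using (_≡_; _≢_; refl; sym; trans; cong; cong₂; subst)
open import Relation.Nullary using (¬_; Dec; yes; no)
open import Relation.Nullary.Decidable
  using (_×-dec_; _⊎-dec_; _→-dec_; ¬?; from-yes; decidable-stable)

-- Graphs coloured with four colours

private variable
  n n′ l l′ : ℕ

-- The numbers of nodes and edges are parameters, so the type of each construction records how it
-- changes them.
record ColoredGraph (n l : ℕ) : Set where
  field
    ends    : Fin l → Fin n × Fin n
    ordered : ∀ e → proj₁ (ends e) Fin.< proj₂ (ends e)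
    simple  : Injective _≡_ _≡_ ends
    color   : Fin l → Fin 4
    onto    : ∀ c → ∃ λ e → color e ≡ c

open ColoredGraph

HasEdge : ColoredGraph n l → Fin 4 → Fin n → Fin n → Set
HasEdge G c u v = ∃ λ e → color G e ≡ c × ends G e ≡ (u , v)

Link : ColoredGraph n l → (Fin 4 → Set) → Fin n → Fin n → Set
Link G P u v = ∃ λ c → P c × (HasEdge G c u v ⊎ HasEdge G c v u)

Joined : ColoredGraph n l → (Fin 4 → Set) → Fin n → Fin n → Set
Joined G P = Star (Link G P)

joined-sym : ∀ (G : ColoredGraph n l) {P u v} → Joined G P u v → Joined G P v u
joined-sym G = reverse λ (c , p , h) → c , p , Sum.swap h

-- `P` may allow more than the colours `i` and `j`, so the complement of a deleted colour set can be
-- put in directly. The order `i < j` halves the cases and makes `j` nonzero.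
TwoColorsConnect : ColoredGraph n l → Set₁
TwoColorsConnect G = ∀ {P} i j → i Fin.< j → P i → P j → ∀ A B → Joined G P A B

-- A walk of `G` is carried along `h` edge by edge, and nodes outside the image of `h` are first
-- joined to it. An extension thus has to treat only single old edges and new nodes.
twoColorsConnect-transfer :
  (G : ColoredGraph n l) (G′ : ColoredGraph n′ l′) (h : Fin n → Fin n′) →
  (∀ {P} i j → i Fin.< j → P i → P j →
    (∀ {c u v} → P c → HasEdge G c u v → Joined G′ P (h u) (h v)) ×
    (∀ A → ∃ λ w → Joined G′ P A (h w))) →
  TwoColorsConnect G → TwoColorsConnect G′
twoColorsConnect-transfer G G′ h transfer conn i j i<j Pi Pj A B
  with transfer i j i<j Pi Pj
... | lift , reach with reach A | reach B
... | a , A~a | b , B~b =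
  A~a ◅◅ kleisliStar h lift′ (conn i j i<j Pi Pj a b) ◅◅ joined-sym G′ B~b
  where
  lift′ : ∀ {u v} → Link G _ u v → Joined G′ _ (h u) (h v)
  lift′ (c , Pc , inj₁ e) = lift Pc e
  lift′ (c , Pc , inj₂ e) = joined-sym G′ (lift Pc e)

-- Elementary changes of a graph

Fresh : {A : Set} → (Fin l → A) → A → Set
Fresh f p = ∀ e → f e ≢ p

∷-fresh : {A : Set} {f : Fin l → A} {p q : A} → p ≢ q → Fresh f q → Fresh (p ∷ᶠ f) q
∷-fresh p≢q fq zero    = p≢q
∷-fresh p≢q fq (suc e) = fq e

updateAt-fresh : {A : Set} {f : Fin l → A} (i : Fin l) {p q : A} → p ≢ q → Fresh f q →
                 Fresh (updateAt f i (const p)) q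
updateAt-fresh {f = f} i p≢q fq d eq with d ≟ i
... | yes refl = p≢q (trans (sym (updateAt-updates i f)) eq)
... | no d≢i   = fq d (trans (sym (updateAt-minimal d i f d≢i)) eq)

addEdge : (G : ColoredGraph n l) (p : Fin n × Fin n) →
          proj₁ p Fin.< proj₂ p → Fresh (ends G) p → Fin 4 → ColoredGraph n (suc l)
addEdge G p p< fresh c = record
  { ends    = p ∷ᶠ ends G
  ; ordered = λ { zero → p< ; (suc e) → ordered G e }
  ; simple  = λ { {zero}  {zero}  _  → refl
                ; {zero}  {suc e} eq → ⊥-elim (fresh e (sym eq))
                ; {suc e} {zero}  eq → ⊥-elim (fresh e eq)
                ; {suc e} {suc d} eq → cong suc (simple G eq) }
  ; color   = c ∷ᶠ color G
  ; onto    = λ b → Product.map suc id (onto G b)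
  }

embed : ColoredGraph n l → ColoredGraph (suc n) l
embed G = record
  { ends    = λ e → Product.map suc suc (ends G e)
  ; ordered = λ e → s<s (ordered G e)
  ; simple  = λ eq → simple G (cong₂ _,_ (suc-injective (,-injectiveˡ eq))
                                          (suc-injective (,-injectiveʳ eq)))
  ; color   = color G
  ; onto    = onto G
  }

embed-edge : ∀ {G : ColoredGraph n l} {c u v} →
             HasEdge G c u v → HasEdge (embed G) c (suc u) (suc v)
embed-edge (e , ce , ee) = e , ce , cong (Product.map suc suc) ee

-- Moving an edge instead of deleting it keeps its index and colour, so the edge count and `onto`
-- carry over.
redirect : (G : ColoredGraph n l) (e : Fin l) (p : Fin n × Fin n) →
           proj₁ p Fin.< proj₂ p → Fresh (ends G) p → ColoredGraph n l
redirect {n} {l} G e p p< fresh = record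
  { ends    = ends′
  ; ordered = ordered′
  ; simple  = simple′
  ; color   = color G
  ; onto    = onto G
  }
  where
  ends′ : Fin l → Fin n × Fin n
  ends′ = updateAt (ends G) e (const p)

  at : ends′ e ≡ p
  at = updateAt-updates e (ends G)

  off : ∀ {d} → d ≢ e → ends′ d ≡ ends G d
  off = updateAt-minimal _ e (ends G)

  ordered′ : ∀ d → proj₁ (ends′ d) Fin.< proj₂ (ends′ d)
  ordered′ d with d ≟ e
  ... | yes refl = subst (λ q → proj₁ q Fin.< proj₂ q) (sym at) p<
  ... | no d≢e   = subst (λ q → proj₁ q Fin.< proj₂ q) (sym (off d≢e)) (ordered G d)

  simple′ : Injective _≡_ _≡_ ends′
  simple′ {c} {d} eq with c ≟ e | d ≟ e
  ... | yes refl | yes refl = refl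
  ... | yes refl | no d≢e = ⊥-elim (fresh d (trans (sym (off d≢e)) (trans (sym eq) at)))
  ... | no c≢e | yes refl = ⊥-elim (fresh c (trans (sym (off c≢e)) (trans eq at)))
  ... | no c≢e | no d≢e = simple G (trans (sym (off c≢e)) (trans eq (off d≢e)))

redirect-edge : ∀ {G : ColoredGraph n l} {e p p< fresh c u v} → HasEdge G c u v →
                HasEdge (redirect G e p p< fresh) c u v ⊎ (color G e ≡ c × ends G e ≡ (u , v))
redirect-edge {G = G} {e} (d , cd , ed) with d ≟ e
... | yes refl = inj₂ (cd , ed)
... | no d≢e   = inj₁ (d , cd , trans (updateAt-minimal d e (ends G) d≢e) ed)

addEdge-connects : ∀ (G : ColoredGraph n l) {p p< fresh c} →
                   TwoColorsConnect G → TwoColorsConnect (addEdge G p p< fresh c)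
addEdge-connects G {p} {p<} {fresh} {c} =
  twoColorsConnect-transfer G (addEdge G p p< fresh c) id λ _ _ _ _ _ →
  (λ Pc h → return (_ , Pc , inj₁ (Product.map suc id h))) , λ A → A , ε

-- The base graph on five nodes

pentagon : ColoredGraph 5 8
pentagon = record
  { ends    = ends′
  ; ordered = from-yes (all? λ e → proj₁ (ends′ e) <? proj₂ (ends′ e))
  ; simple  = λ {x} {y} → from-yes (all? λ d → all? λ e →
                ≡-dec _≟_ _≟_ (ends′ d) (ends′ e) →-dec d ≟ e) x y
  ; color   = color′
  ; onto    = from-yes (all? λ c → any? λ e → color′ e ≟ c)
  }
  where
  -- The edge {a , b} has colour a + b mod 5; the class a + b = 4 is left out.
  ends′ : Fin 8 → Fin 5 × Fin 5
  ends′ = lookup ((1F , 4F) ∷ (2F , 3F) ∷ (0F , 1F) ∷ (2F , 4F) ∷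
                  (0F , 2F) ∷ (3F , 4F) ∷ (0F , 3F) ∷ (1F , 2F) ∷ [])

  color′ : Fin 8 → Fin 4
  color′ = lookup (0F ∷ 0F ∷ 1F ∷ 1F ∷ 2F ∷ 2F ∷ 3F ∷ 3F ∷ [])

module _ (G : ColoredGraph n l) (i j : Fin 4) where

  -- A bounded form of `Joined` for two fixed colours, written with equations so that `within?` can
  -- decide it by finite search.
  Within : ℕ → Fin n → Fin n → Set
  Within zero    A B = A ≡ B
  Within (suc k) A B = A ≡ B ⊎ ∃ λ e → (i ≡ color G e ⊎ j ≡ color G e) ×
    ((A ≡ proj₁ (ends G e) × Within k (proj₂ (ends G e)) B) ⊎
     (A ≡ proj₂ (ends G e) × Within k (proj₁ (ends G e)) B))

  within? : ∀ k A B → Dec (Within k A B)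
  within? zero    A B = A ≟ B
  within? (suc k) A B = A ≟ B ⊎-dec any? λ e → (i ≟ color G e ⊎-dec j ≟ color G e) ×-dec
    ((A ≟ proj₁ (ends G e) ×-dec within? k (proj₂ (ends G e)) B) ⊎-dec
     (A ≟ proj₂ (ends G e) ×-dec within? k (proj₁ (ends G e)) B))

  within⇒joined : ∀ {P} → P i → P j → ∀ k {A B} → Within k A B → Joined G P A B
  within⇒joined Pi Pj zero    refl        = ε
  within⇒joined Pi Pj (suc k) (inj₁ refl) = ε
  within⇒joined Pi Pj (suc k) (inj₂ (e , ij , inj₁ (refl , w))) =
    (_ , [ (λ { refl → Pi }) , (λ { refl → Pj }) ]′ ij , inj₁ (e , refl , refl)) ◅
    within⇒joined Pi Pj k w
  within⇒joined Pi Pj (suc k) (inj₂ (e , ij , inj₂ (refl , w))) =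
    (_ , [ (λ { refl → Pi }) , (λ { refl → Pj }) ]′ ij , inj₂ (e , refl , refl)) ◅
    within⇒joined Pi Pj k w

pentagon-connects : TwoColorsConnect pentagon
pentagon-connects i j i<j Pi Pj A B = from-0 A ◅◅ joined-sym pentagon (from-0 B)
  where
  from-0 : ∀ A → Joined pentagon _ A 0F
  -- For distinct colours c and d, the reflections a ↦ c - a and a ↦ d - a mod 5 compose to a
  -- rotation that generates Z₅, so the two classes form a path through all five nodes. Hence four
  -- steps suffice.
  from-0 A = within⇒joined pentagon i j Pi Pj 4
    (from-yes (all? λ i → all? λ j → i <? j →-dec all? λ A → within? pentagon i j 4 A 0F)
      i j i<j A)

-- Extension by one node and by two nodes

module AddNode (G : ColoredGraph (3 + n) l) where

  G₁ G₂ G₃ : ColoredGraph _ _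
  G₁ = addEdge (embed G) (0F , 1F) z<s (λ _ ()) 1F
  G₂ = addEdge G₁ (0F , 2F) z<s (∷-fresh (λ ()) λ _ ()) 2F
  G₃ = addEdge G₂ (0F , 3F) z<s
         (∷-fresh (λ ()) (∷-fresh (λ ()) λ _ ())) 3F

  connects : TwoColorsConnect G → TwoColorsConnect G₃
  connects = twoColorsConnect-transfer G G₃ suc λ {P} i j i<j Pi Pj →
    (λ Pc h → return (_ , Pc , inj₁
       (Product.map (λ e → suc (suc (suc e))) id (embed-edge {G = G} h)))) ,
    -- The new node has an edge of every colour except 0, and the larger colour `j` is never 0.
    λ { zero → attach P j (λ { refl → ℕₚ.n≮0 i<j }) Pj ; (suc A) → A , ε }
    where
    attach : ∀ P j → j ≢ 0F → P j → ∃ λ w → Joined G₃ P 0F (suc w)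
    attach P 0F j≢0 Pj = ⊥-elim (j≢0 refl)
    -- The edge added last has index 0, so the edge of colour 1 has index 2.
    attach P 1F _   Pj = 0F , return (1F , Pj , inj₁ (2F , refl , refl))
    attach P 2F _   Pj = 1F , return (2F , Pj , inj₁ (1F , refl , refl))
    attach P 3F _   Pj = 2F , return (3F , Pj , inj₁ (0F , refl , refl))

-- A colour-0 edge u v gives way to two new nodes x = 0, y = 1 and the edges
-- x u, y v (colour 0), x v (colour 1), y u (colour 2), x y (colour 3).
module AddTwoNodes (G : ColoredGraph n l) where

  e₀ : Fin l
  e₀ = proj₁ (onto G 0F)

  u v : Fin n
  u = proj₁ (ends G e₀)
  v = proj₂ (ends G e₀)

  x y u″ v″ : Fin (2 + n)
  x  = 0F
  y  = 1F
  u″ = suc (suc u)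
  v″ = suc (suc v)

  u″≢v″ : ∀ {a : Fin (2 + n)} → (a , u″) ≢ (a , v″)
  u″≢v″ eq = Finₚ.<⇒≢ (ordered G e₀) (suc-injective (suc-injective (,-injectiveʳ eq)))

  G₀ G₁ : ColoredGraph (2 + n) l
  G₀ = embed (embed G)
  -- `e₀` itself becomes x u, so only four edges have to be added.
  G₁ = redirect G₀ e₀ (x , u″) z<s λ _ ()

  G₂ G₃ G₄ G₅ : ColoredGraph (2 + n) _
  G₂ = addEdge G₁ (y , v″) (s<s z<s) (updateAt-fresh e₀ (λ ()) λ _ ()) 0F
  G₃ = addEdge G₂ (x , v″) z<s
         (∷-fresh (λ ()) (updateAt-fresh e₀ u″≢v″ λ _ ())) 1F
  G₄ = addEdge G₃ (y , u″) (s<s z<s)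
         (∷-fresh (λ ()) (∷-fresh (u″≢v″ ∘ sym)
           (updateAt-fresh e₀ (λ ()) λ _ ()))) 2F
  G₅ = addEdge G₄ (x , y) z<s
         (∷-fresh (λ ()) (∷-fresh (λ ()) (∷-fresh (λ ())
           (updateAt-fresh e₀ (λ ()) λ _ ())))) 3F

  keep⁴ : ∀ {c a b} → HasEdge G₁ c a b → HasEdge G₅ c a b
  keep⁴ (e , h) = suc (suc (suc (suc e))) , h

  module _ {P : Fin 4 → Set} where

    edge : ∀ {c a b} → P c → HasEdge G₅ c a b → Joined G₅ P a b
    edge Pc h = return (_ , Pc , inj₁ h)

    x~u : P 0F → Joined G₅ P x u″
    x~u P0 = edge P0 (keep⁴ (e₀ , proj₂ (onto G 0F) , updateAt-updates e₀ (ends G₀)))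

    y~v : P 0F → Joined G₅ P y v″
    y~v P0 = edge P0 (3F , refl , refl)

    x~v : P 1F → Joined G₅ P x v″
    x~v P1 = edge P1 (2F , refl , refl)

    y~u : P 2F → Joined G₅ P y u″
    y~u P2 = edge P2 (1F , refl , refl)

    x~y : P 3F → Joined G₅ P x y
    x~y P3 = edge P3 (0F , refl , refl)

    flip : ∀ {a b} → Joined G₅ P a b → Joined G₅ P b a
    flip = joined-sym G₅

    -- Makes up for the lost edge u v: x u and y v have colour 0, and any one of the colours 1, 2, 3
    -- closes a detour through x, y or both.
    bridge : ∀ j → j ≢ 0F → P 0F → P j → Joined G₅ P u″ v″
    bridge 0F j≢0 _  _  = ⊥-elim (j≢0 refl)
    bridge 1F _   P0 P1 = flip (x~u P0) ◅◅ x~v P1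
    bridge 2F _   P0 P2 = flip (y~u P2) ◅◅ y~v P0
    bridge 3F _   P0 P3 = flip (x~u P0) ◅◅ x~y P3 ◅◅ y~v P0

    Attached : Fin (2 + n) → Set
    Attached a = ∃ λ w → Joined G₅ P a (suc (suc w))

    -- Colour 0 attaches both x and y to old nodes, colours 1 and 2 attach one of them each, and
    -- colour 3 joins x to y, so that one can use the edge of the other.
    attached : ∀ i j → i Fin.< j → P i → P j → Attached x × Attached y
    attached 0F _  _ P0 _  = (u , x~u P0) , (v , y~v P0)
    attached 1F 2F _ P1 P2 = (v , x~v P1) , (u , y~u P2)
    attached 1F 3F _ P1 P3 = (v , x~v P1) , (v , flip (x~y P3) ◅◅ x~v P1)
    attached 2F 3F _ P2 P3 = (u , x~y P3 ◅◅ y~u P2) , (u , y~u P2)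
    attached 1F 1F (s≤s ()) _ _
    attached 2F 1F (s≤s ()) _ _
    attached 2F 2F (s≤s (s≤s ())) _ _
    attached 3F 1F (s≤s ()) _ _
    attached 3F 2F (s≤s (s≤s ())) _ _
    attached 3F 3F (s≤s (s≤s (s≤s ()))) _ _

    bridge′ : ∀ i j → i Fin.< j → P i → P j → P 0F → Joined G₅ P u″ v″
    -- Even if `i` is not 0, the nonzero `j` is the second colour that `bridge` needs.
    bridge′ i j i<j Pi Pj P0 = bridge j (λ { refl → ℕₚ.n≮0 i<j }) P0 Pj

  connects : TwoColorsConnect G → TwoColorsConnect G₅
  connects = twoColorsConnect-transfer G G₅ (λ w → suc (suc w)) λ {P} i j i<j Pi Pj →
    (λ Pc h → lift (bridge′ i j i<j Pi Pj) Pc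
                (redirect-edge {G = G₀} {e = e₀} {x , u″} {z<s} {λ _ ()}
                  (embed-edge {G = embed G} (embed-edge {G = G} h)))) ,
    λ { 0F → proj₁ (attached i j i<j Pi Pj)
      ; 1F → proj₂ (attached i j i<j Pi Pj)
      ; (suc (suc A)) → A , ε }
    where
    lift : ∀ {P c a b} → (P 0F → Joined G₅ P u″ v″) → P c →
           HasEdge G₁ c a b ⊎ (color G₀ e₀ ≡ c × ends G₀ e₀ ≡ (a , b)) → Joined G₅ P a b
    lift br Pc (inj₁ h) = edge Pc (keep⁴ h)
    -- The lost edge has colour 0, so a walk that uses it has `P 0F` at hand.
    lift {P} br Pc (inj₂ (refl , refl)) = br (subst P (proj₂ (onto G 0F)) Pc)

-- Graphs with 2 n - 2 edges for odd n and 2 n - 1 for even n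

GoodGraph : ℕ → ℕ → Set₁
GoodGraph n l = Σ (ColoredGraph n l) TwoColorsConnect

goodOdd : ∀ k → GoodGraph (5 + 2 * k) (8 + 4 * k)
goodOdd zero    = pentagon , pentagon-connects
goodOdd (suc k) =
  subst (λ n → GoodGraph n (8 + 4 * suc k)) (nodes k) (subst (GoodGraph _) (edges k) step)
  where
  G : ColoredGraph (5 + 2 * k) (8 + 4 * k)
  G = proj₁ (goodOdd k)

  step : GoodGraph (2 + (5 + 2 * k)) (4 + (8 + 4 * k))
  step = AddTwoNodes.G₅ G , AddTwoNodes.connects G (proj₂ (goodOdd k))

  nodes : ∀ k → 2 + (5 + 2 * k) ≡ 5 + 2 * suc k
  nodes = solve-∀

  edges : ∀ k → 4 + (8 + 4 * k) ≡ 8 + 4 * suc k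
  edges = solve-∀

goodEven : ∀ k → GoodGraph (6 + 2 * k) (11 + 4 * k)
goodEven k = let G , conn = goodOdd k in AddNode.G₃ G , AddNode.connects G conn

-- Filling up with further edges

-- The binomial coefficient n over 2, in the recursion that `pair` follows: n pairs contain node 0,
-- the others lie among the remaining nodes.
triangle : ℕ → ℕ
triangle zero    = 0
triangle (suc n) = n + triangle n

triangle*2 : ∀ n → triangle n * 2 ≡ n * (n ∸ 1)
triangle*2 zero          = refl
triangle*2 (suc zero)    = refl
triangle*2 (suc (suc n)) =
  trans (ℕₚ.*-distribʳ-+ 2 (suc n) (triangle (suc n)))
        (trans (cong (suc n * 2 +_) (triangle*2 (suc n))) (expand n))
  where
  expand : ∀ n → suc n * 2 + suc n * n ≡ (2 + n) * suc n
  expand = solve-∀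

triangle≡ : ∀ n → n * (n ∸ 1) / 2 ≡ triangle n
triangle≡ n = trans (cong (_/ 2) (sym (triangle*2 n))) (m*n/n≡m (triangle n) 2)

pair : ∀ n → Fin (triangle n) → Fin n × Fin n
pair (suc n) i =
  [ (λ j → zero , suc j) , Product.map suc suc ∘ pair n ]′ (splitAt n i)

pair-ordered : ∀ n i → proj₁ (pair n i) Fin.< proj₂ (pair n i)
pair-ordered (suc n) i with splitAt n i
... | inj₁ j = z<s
... | inj₂ j = s<s (pair-ordered n j)

pair-injective : ∀ n → Injective _≡_ _≡_ (pair n)
pair-injective (suc n) {i} {j} eq =
  trans (sym (join-splitAt n (triangle n) i))
        (trans (cong (join n (triangle n)) (split-eq (splitAt n i) (splitAt n j) eq))
               (join-splitAt n (triangle n) j))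
  where
  node : Fin n ⊎ Fin (triangle n) → Fin (suc n) × Fin (suc n)
  node = [ (λ j → zero , suc j) , Product.map suc suc ∘ pair n ]′

  split-eq : ∀ a b → node a ≡ node b → a ≡ b
  split-eq (inj₁ a) (inj₁ b) eq = cong inj₁ (suc-injective (,-injectiveʳ eq))
  split-eq (inj₂ a) (inj₂ b) eq = cong inj₂ (pair-injective n
    (cong₂ _,_ (suc-injective (,-injectiveˡ eq)) (suc-injective (,-injectiveʳ eq))))

-- Pigeonhole principle: if every pair were an edge, choosing its edge would inject
-- `Fin (triangle n)` into `Fin l`.
vacancy : (G : ColoredGraph n l) → l < triangle n →
          ∃ λ i → Fresh (ends G) (pair n i)
vacancy {n} {l} G l<T with any? (λ i → ¬? (any? λ e → ≡-dec _≟_ _≟_ (ends G e) (pair n i)))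
... | yes (i , free) = i , λ e eq → free (e , eq)
... | no full = ⊥-elim (ℕₚ.<⇒≱ l<T (injective⇒≤ edge-at-injective))
  where
  taken : ∀ i → ∃ λ e → ends G e ≡ pair n i
  taken i = decidable-stable (any? λ e → ≡-dec _≟_ _≟_ (ends G e) (pair n i))
                             λ free → full (i , free)

  edge-at-injective : Injective _≡_ _≡_ (proj₁ ∘ taken)
  edge-at-injective {i} {j} eq = pair-injective n
    (trans (sym (proj₂ (taken i))) (trans (cong (ends G) eq) (proj₂ (taken j))))

addEdges : ∀ d → GoodGraph n l → d + l ≤ triangle n → GoodGraph n (d + l)
addEdges     zero    G _ = G
addEdges {n} (suc d) G d≤ with addEdges d G (ℕₚ.<⇒≤ d≤)
... | G′ , conn with vacancy G′ d≤
... | i , fresh =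
  -- All colours occur already, so any colour serves for the new edge.
  addEdge G′ (pair n i) (pair-ordered n i) fresh 0F ,
  addEdge-connects G′ {p< = pair-ordered n i} {fresh} conn

enlarge : GoodGraph n l → l ≤ l′ → l′ ≤ triangle n → GoodGraph n l′
enlarge {n} {l} {l′} G l≤l′ l′≤T = subst (GoodGraph n) eq
  (addEdges (l′ ∸ l) G (≤-trans (≤-reflexive eq) l′≤T))
  where
  eq : l′ ∸ l + l ≡ l′
  eq = ℕₚ.m∸n+n≡m l≤l′

-- The cases of n

parity : ∀ n → ∃ λ k → n ≡ 2 * k ⊎ n ≡ 2 * k + 1
parity zero = 0 , inj₁ refl
parity (suc n) with parity n
... | k , inj₁ refl = k , inj₂ (ℕₚ.+-comm 1 (2 * k))
... | k , inj₂ refl = suc k , inj₁ (double k)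
  where
  double : ∀ k → suc (2 * k + 1) ≡ 2 * suc k
  double = solve-∀

-- In terms of n the bounds are 2 n - 1 for even n and 2 n - 2 for odd n.
EvenBound OddBound : ℕ → ℕ → Set
EvenBound n l = ∀ k → 0 < k → n ≡ 2 * k → 4 * k ∸ 1 ≤ l
OddBound  n l = ∀ k → 0 < k → n ≡ 2 * k + 1 → 4 * k ≤ l

-- Up to n = 3 there is no room for four edges. From n = 5 on, the graphs above have exactly the
-- number of edges in the bound and are filled up to `l`.
goodGraph : ∀ n l → 0 < n → 4 ≤ l → l ≤ triangle n →
            EvenBound n l → OddBound n l → GoodGraph n l
goodGraph n l 0<n 4≤l l≤T even odd with parity n
goodGraph n l ()  4≤l l≤T even odd | 0 , inj₁ refl
goodGraph n l 0<n 4≤l l≤T even odd | 1 , inj₁ refl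
  with s≤s () ← ≤-trans 4≤l l≤T
-- For n = 4 the bound asks for seven edges, but K₄ has only six.
goodGraph n l 0<n 4≤l l≤T even odd | 2 , inj₁ refl =
  ⊥-elim (ℕₚ.1+n≰n (≤-trans (even 2 z<s refl) l≤T))
goodGraph n l 0<n 4≤l l≤T even odd | suc (suc (suc k)) , inj₁ refl =
  enlarge (subst (λ n → GoodGraph n (11 + 4 * k)) (nodes k) (goodEven k))
          (≤-trans (≤-reflexive (edges k)) (even (3 + k) z<s refl)) l≤T
  where
  nodes : ∀ k → 6 + 2 * k ≡ 2 * (3 + k)
  nodes = solve-∀
  edges : ∀ k → 11 + 4 * k ≡ 4 * (3 + k) ∸ 1
  edges k = cong (_∸ 1) (expand k)
    where
    expand : ∀ k → 12 + 4 * k ≡ 4 * (3 + k)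
    expand = solve-∀
goodGraph n l 0<n 4≤l l≤T even odd | 0 , inj₂ refl 
  with () ← ≤-trans 4≤l l≤T
goodGraph n l 0<n 4≤l l≤T even odd | 1 , inj₂ refl = ⊥-elim (ℕₚ.1+n≰n (≤-trans 4≤l l≤T))
goodGraph n l 0<n 4≤l l≤T even odd | suc (suc k) , inj₂ refl =
  enlarge (subst (λ n → GoodGraph n (8 + 4 * k)) (nodes k) (goodOdd k))
          (≤-trans (≤-reflexive (edges k)) (odd (2 + k) z<s refl)) l≤T
  where
  nodes : ∀ k → 5 + 2 * k ≡ 2 * (2 + k) + 1
  nodes = solve-∀
  edges : ∀ k → 8 + 4 * k ≡ 4 * (2 + k)
  edges = solve-∀

-- From walks to paths, and three-color connectivity

module _ (G : ColoredEdgeGraph) where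

  open ColoredEdgeGraph G using (V; E; Step; Walk; Path; nodes)
  open ColoredEdgeGraph G using () renaming (edges to walkEdges)
  open import Data.List.Membership.DecPropositional {A = V} _≟_ using () renaming (_∈?_ to _∈ˡ?_)

  PathWith : (E → Set) → V → V → Set
  PathWith Q A B = Σ (Path A B) λ p → All Q (walkEdges (proj₁ p))

  suffix : ∀ {Q u v B} (w : Walk v B) → Unique (nodes w) → All Q (walkEdges w) →
           u ∈ˡ nodes w → PathWith Q u B
  suffix ε             uniq       qs       (here refl) = (ε , uniq) , qs
  suffix ((e , s) ◅ w) uniq       qs       (here refl) = ((e , s) ◅ w , uniq) , qs
  suffix ((e , s) ◅ w) (_ ∷ uniq) (_ ∷ qs) (there u∈w) = suffix w uniq qs u∈w

  -- Induction on the walk: its tail is turned into a path first, and if `A` already lies on that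
  -- path, the part from `A` on is taken.
  loopErase : ∀ {Q A B} → Star (λ u v → Σ (Step u v) (Q ∘ proj₁)) A B → PathWith Q A B
  loopErase ε = (ε , [] ∷ []) , []
  loopErase {A = A} (((e , s) , q) ◅ w) with loopErase w
  ... | (w′ , uniq) , qs with A ∈ˡ? nodes w′
  ... | yes A∈w′ = suffix w′ uniq qs A∈w′
  ... | no A∉w′  = ((e , s) ◅ w′ , ¬Any⇒All¬ _ A∉w′ ∷ uniq) , q ∷ qs

missingOne : (p : Subset n) → ∣ p ∣ < n → ∃ λ i → i ∉ p
missingOne (true  ∷ p) (s≤s p<n) =
  let i , i∉p = missingOne p p<n in suc i , λ { (there i∈p) → i∉p i∈p }
missingOne (false ∷ p) _ = zero , λ ()

-- Supplies two colours that survive the deletion, in the order that `TwoColorsConnect` expects.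
missingTwo : (p : Subset n) → 2 + ∣ p ∣ ≤ n → ∃₂ λ i j → i Fin.< j × i ∉ p × j ∉ p
missingTwo (true ∷ p) (s≤s p≤n) =
  let i , j , i<j , i∉p , j∉p = missingTwo p p≤n in
  suc i , suc j , s<s i<j , (λ { (there i∈p) → i∉p i∈p }) , λ { (there j∈p) → j∉p j∈p }
missingTwo (false ∷ p) (s≤s p≤n) =
  let j , j∉p = missingOne p p≤n in
  zero , suc j , z<s , (λ ()) , λ { (there j∈p) → j∉p j∈p }

toColoredEdgeGraph : ColoredGraph n l → ColoredEdgeGraph
toColoredEdgeGraph {n} {l} G = record
  { ∣V∣ = n ; ∣E∣ = l ; ∣C∣ = 4
  ; ends = ends G ; ordered = ordered G ; simple = simple G ; f = color G
  ; surjective = λ c → let e , eq = onto G c in e , λ { refl → eq }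
  }

is3ColorConnected : (G : ColoredGraph n l) → TwoColorsConnect G →
                    Is[ 2 +1]-ColorConnected (toColoredEdgeGraph G)
is3ColorConnected G conn A B A≢B Cₜ ∣Cₜ∣≡2
  with missingTwo Cₜ (≤-reflexive (cong (2 +_) ∣Cₜ∣≡2))
... | i , j , i<j , i∉Cₜ , j∉Cₜ = loopErase (toColoredEdgeGraph G)
  -- Here `P` is `_∉ Cₜ`, so every link of the walk has a surviving colour.
  (kleisliStar id (return ∘ step) (conn i j i<j i∉Cₜ j∉Cₜ A B))
  where
  step : ∀ {u v} → Link G (_∉ Cₜ) u v →
         Σ (ColoredEdgeGraph.Step (toColoredEdgeGraph G) u v) λ s → color G (proj₁ s) ∉ Cₜ
  step (_ , c∉Cₜ , inj₁ (e , refl , eq)) = (e , inj₁ eq) , c∉Cₜ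
  step (_ , c∉Cₜ , inj₂ (e , refl , eq)) = (e , inj₂ eq) , c∉Cₜ

-- Block sizes of a partition

∣p∪q∣≤∣p∣+∣q∣ : (p q : Subset n) → ∣ p ∪ q ∣ ≤ ∣ p ∣ + ∣ q ∣
∣p∪q∣≤∣p∣+∣q∣ []          []          = z≤n
∣p∪q∣≤∣p∣+∣q∣ (true  ∷ p) (true  ∷ q) =
  s≤s (≤-trans (∣p∪q∣≤∣p∣+∣q∣ p q) (ℕₚ.+-monoʳ-≤ ∣ p ∣ (ℕₚ.n≤1+n ∣ q ∣)))
∣p∪q∣≤∣p∣+∣q∣ (true  ∷ p) (false ∷ q) = s≤s (∣p∪q∣≤∣p∣+∣q∣ p q)
∣p∪q∣≤∣p∣+∣q∣ (false ∷ p) (true  ∷ q) =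
  ≤-trans (s≤s (∣p∪q∣≤∣p∣+∣q∣ p q)) (≤-reflexive (sym (ℕₚ.+-suc ∣ p ∣ ∣ q ∣)))
∣p∪q∣≤∣p∣+∣q∣ (false ∷ p) (false ∷ q) = ∣p∪q∣≤∣p∣+∣q∣ p q

∣p∣+∣q∣≤∣p∪q∣ : (p q : Subset n) → Empty (p ∩ q) → ∣ p ∣ + ∣ q ∣ ≤ ∣ p ∪ q ∣
∣p∣+∣q∣≤∣p∪q∣ []          []          _ = z≤n
∣p∣+∣q∣≤∣p∪q∣ (true  ∷ p) (true  ∷ q) e = ⊥-elim (e (zero , here))
∣p∣+∣q∣≤∣p∪q∣ (true  ∷ p) (false ∷ q) e =
  s≤s (∣p∣+∣q∣≤∣p∪q∣ p q (e ∘ Product.map suc there))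
∣p∣+∣q∣≤∣p∪q∣ (false ∷ p) (true  ∷ q) e =
  ≤-trans (≤-reflexive (ℕₚ.+-suc ∣ p ∣ ∣ q ∣))
          (s≤s (∣p∣+∣q∣≤∣p∪q∣ p q (e ∘ Product.map suc there)))
∣p∣+∣q∣≤∣p∪q∣ (false ∷ p) (false ∷ q) e =
  ∣p∣+∣q∣≤∣p∪q∣ p q (e ∘ Product.map suc there)

otherTwo : ∀ (k h : Fin 4) → k ≢ h → ∃₂ λ i j → i ≢ j ×
           (∀ x → (x ≡ i ⊎ x ≡ j) ⊎ (x ≡ k ⊎ x ≡ h))
otherTwo = from-yes (all? {4} λ k → all? λ h → ¬? (k ≟ h) →-dec
  any? λ i → any? λ j → ¬? (i ≟ j) ×-dec
    all? λ x → (x ≟ i ⊎-dec x ≟ j) ⊎-dec (x ≟ k ⊎-dec x ≟ h))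

module _ (𝓕 : Partition l 4) where

  open Partition 𝓕

  size : Fin 4 → ℕ
  size i = ∣ block i ∣

  -- Pairing the blocks reduces the disjointness of four sets to `q ⊆ ∁ p`.
  sizes≤ : (size 0F + size 1F) + (size 2F + size 3F) ≤ l
  sizes≤ = begin
    (size 0F + size 1F) + (size 2F + size 3F)
      ≤⟨ +-mono-≤ (∣p∣+∣q∣≤∣p∪q∣ _ _ (disjoint 0F 1F λ ()))
                  (∣p∣+∣q∣≤∣p∪q∣ _ _ (disjoint 2F 3F λ ())) ⟩
    ∣ p ∣ + ∣ q ∣
      ≤⟨ ℕₚ.+-monoʳ-≤ ∣ p ∣ (p⊆q⇒∣p∣≤∣q∣ q⊆∁p) ⟩
    ∣ p ∣ + ∣ ∁ p ∣
      ≡⟨ cong (∣ p ∣ +_) (∣∁p∣≡n∸∣p∣ p) ⟩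
    ∣ p ∣ + (l ∸ ∣ p ∣)
      ≡⟨ ℕₚ.m+[n∸m]≡n (∣p∣≤n p) ⟩
    l ∎
    where
    open ℕₚ.≤-Reasoning
    p q : Subset l
    p = block 0F ∪ block 1F
    q = block 2F ∪ block 3F

    apart : ∀ {i j x} → i ≢ j → x ∈ block i → ¬ (x ∈ block j)
    apart {i} {j} i≢j x∈i x∈j = disjoint i j i≢j (_ , x∈p∩q⁺ (x∈i , x∈j))

    q⊆∁p : q ⊆ ∁ p
    q⊆∁p x∈q = x∉p⇒x∈∁p λ x∈p → [ (λ x∈2 → [ apart (λ ()) x∈2 , apart (λ ()) x∈2 ]′ (x∈p∪q⁻ _ _ x∈p))
                                 , (λ x∈3 → [ apart (λ ()) x∈3 , apart (λ ()) x∈3 ]′ (x∈p∪q⁻ _ _ x∈p)) ]′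
                                 (x∈p∪q⁻ _ _ x∈q)

  -- Removing the other two blocks leaves only elements of blocks `k` and `h`, and the minimum `μ`
  -- is at most the number left.
  μ≤sizes : ∀ {μ} → IsMinimum (Remainder 𝓕 2) μ → ∀ k h → k ≢ h → μ ≤ size k + size h
  μ≤sizes (_ , least) k h k≢h with otherTwo k h k≢h
  ... | i , j , i≢j , cover = ≤-trans (least _ (B , B-injective , refl))
    (≤-trans (p⊆q⇒∣p∣≤∣q∣ rest⊆) (∣p∪q∣≤∣p∣+∣q∣ (block k) (block h)))
    where
    B : Fin 2 → Fin 4
    B = i ∷ᶠ λ _ → j

    B-injective : Injective _≡_ _≡_ B
    B-injective {0F} {0F} _  = refl
    B-injective {0F} {1F} eq = ⊥-elim (i≢j eq)
    B-injective {1F} {0F} eq = ⊥-elim (i≢j (sym eq))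
    B-injective {1F} {1F} _  = refl

    rest⊆ : ∁ (⋃ (tabulate λ a → block (B a))) ⊆ block k ∪ block h
    rest⊆ {x} x∈∁ with covers x
    ... | b , x∈b with cover b
    ... | inj₁ (inj₁ refl) = ⊥-elim (x∈∁p⇒x∉p x∈∁ (x∈p∪q⁺ (inj₁ x∈b)))
    ... | inj₁ (inj₂ refl) = ⊥-elim (x∈∁p⇒x∉p x∈∁ (x∈p∪q⁺ (inj₂ (x∈p∪q⁺ (inj₁ x∈b)))))
    ... | inj₂ (inj₁ refl) = x∈p∪q⁺ (inj₁ x∈b)
    ... | inj₂ (inj₂ refl) = x∈p∪q⁺ (inj₂ x∈b)

-- At most one of the four numbers is below k + 1, so some two of them add up to at
-- least 2 (k + 1), one more than the hypothesis gives for the other two.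
fourSum-even : ∀ k (b : Fin 4 → ℕ) → (∀ i j → i ≢ j → 2 * suc k ∸ 1 ≤ b i + b j) →
               4 * suc k ∸ 1 ≤ (b 0F + b 1F) + (b 2F + b 3F)
fourSum-even k b pairs = cases (suc k ℕₚ.≤? b 0F) (suc k ℕₚ.≤? b 1F)
  where
  other : ∀ i j → i ≢ j → ¬ (suc k ≤ b i) → suc k ≤ b j
  -- `2 * suc k ∸ 1` reduces to `k + suc (k + 0)`; since `b i` is at most `k`, cancelling `k` leaves
  -- the bound on `b j`.
  other i j i≢j k≮i = subst (λ m → suc m ≤ b j) (ℕₚ.+-identityʳ k)
    (ℕₚ.+-cancelˡ-≤ k _ _ (≤-trans (pairs i j i≢j) (ℕₚ.+-monoˡ-≤ (b j) (s≤s⁻¹ (ℕₚ.≰⇒> k≮i)))))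

  total : ∀ k → (suc k + suc k) + (k + suc (k + 0)) ≡ k + (suc k + (suc k + (suc k + 0)))
  total = solve-∀

  add : ∀ {w x yz t} → suc k ≤ w → suc k ≤ x → 2 * suc k ∸ 1 ≤ yz →
        (w + x) + yz ≡ t → 4 * suc k ∸ 1 ≤ t
  add k<w k<x 2k≤yz refl = ≤-trans (≤-reflexive (sym (total k))) (+-mono-≤ (+-mono-≤ k<w k<x) 2k≤yz)

  swap₀ : ∀ a b c d → (b + c) + (a + d) ≡ (a + b) + (c + d)
  swap₀ = solve-∀

  swap₁ : ∀ a b c d → (a + c) + (b + d) ≡ (a + b) + (c + d)
  swap₁ = solve-∀

  cases : Dec (suc k ≤ b 0F) → Dec (suc k ≤ b 1F) →
          4 * suc k ∸ 1 ≤ (b 0F + b 1F) + (b 2F + b 3F)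
  cases (yes k<0) (yes k<1) = add k<0 k<1 (pairs 2F 3F λ ()) refl
  cases (yes k<0) (no k≮1)  = add k<0 (other 1F 2F (λ ()) k≮1) (pairs 1F 3F λ ())
                                (swap₁ (b 0F) (b 1F) (b 2F) (b 3F))
  cases (no k≮0)  _         = add (other 0F 1F (λ ()) k≮0) (other 0F 2F (λ ()) k≮0)
                                (pairs 0F 3F λ ()) (swap₀ (b 0F) (b 1F) (b 2F) (b 3F))

-- Lower bounds on l from μ

module _ {μ : ℕ} (isμ : μ[ l , 4 ⨾ 2 ]≡ μ) (n-1≤μ : n ∸ 1 ≤ μ) where

  private
    𝓕 : Partition l 4
    -- A partition that attains the maximum μ(l, 4; 2).
    𝓕 = proj₁ (proj₁ isμ)

    pairs : ∀ i j → i ≢ j → n ∸ 1 ≤ size 𝓕 i + size 𝓕 j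
    pairs i j i≢j = ≤-trans n-1≤μ (μ≤sizes 𝓕 (proj₂ (proj₁ isμ)) i j i≢j)

  evenBound : EvenBound n l
  evenBound (suc k) _ refl = ≤-trans (fourSum-even k (size 𝓕) pairs) (sizes≤ 𝓕)

  -- The four blocks form two pairs, each with at least n - 1 = 2 k elements.
  oddBound : OddBound n l
  oddBound k _ refl = ≤-trans (≤-reflexive (halves k))
    (≤-trans (+-mono-≤ (pairs 0F 1F λ ()) (pairs 2F 3F λ ())) (sizes≤ 𝓕))
    where
    halves : ∀ k → 4 * k ≡ (2 * k + 1 ∸ 1) + (2 * k + 1 ∸ 1)
    halves k = trans (double k) (sym (cong₂ _+_ (ℕₚ.m+n∸n≡m (2 * k) 1) (ℕₚ.m+n∸n≡m (2 * k) 1)))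
      where
      double : ∀ k → 4 * k ≡ 2 * k + 2 * k
      double = solve-∀

theorem5p6 : ∀ (n l : ℕ) → 0 < n → 0 < l → 4 ≤ l → l ≤ n * (n ∸ 1) / 2 →
    ((∀ (μ : ℕ) → μ[ l , 4 ⨾ 2 ]≡ μ → n ∸ 1 ≤ μ → 3 * n ≤ 2 * l →
    Σ ColoredEdgeGraph λ G →
    Is[ 2 +1]-ColorConnected G × ∣V∣ G ≡ n × ∣E∣ G ≡ l × ∣C∣ G ≡ 4)
    ×
    (3 * n ≤ 2 * l →
    (∀ (k : ℕ) → 0 < k → n ≡ 2 * k → 4 * k ∸ 1 ≤ l) →
    (∀ (k : ℕ) → 0 < k → n ≡ 2 * k + 1 → 4 * k ≤ l) →
    Σ ColoredEdgeGraph λ G →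
    Is[ 2 +1]-ColorConnected G × ∣V∣ G ≡ n × ∣E∣ G ≡ l × ∣C∣ G ≡ 4))
theorem5p6 n l 0<n _ 4≤l l≤ =
  -- In (a) the bounds on `l` are derived from μ, in (b) they are given.
  (λ μ isμ n-1≤μ _ → build (evenBound isμ n-1≤μ) (oddBound isμ n-1≤μ)) , λ _ → build
  where
  build : EvenBound n l → OddBound n l →
          Σ ColoredEdgeGraph λ G →
            Is[ 2 +1]-ColorConnected G × ∣V∣ G ≡ n × ∣E∣ G ≡ l × ∣C∣ G ≡ 4
  build even odd =
    let G , conn = goodGraph n l 0<n 4≤l (subst (l ≤_) (triangle≡ n) l≤) even odd
    in toColoredEdgeGraph G , is3ColorConnected G conn , refl , refl , refl
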